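{- For every even $n\ge 4$, the cycle graph $C_n$ satisfies $\operatorname{nim}(\mathrm{TER}(C_n))=0$.
   Context: $C_n$ is the cycle graph with vertices $v_1,\dots,v_n$, where $v_i$ is adjacent to $v_{i+1}$ (indices modulo $n$). For a graph $G$ with vertex set $V$, a set $K\subseteq V$ is convex if it contains every vertex lying on any shortest path between two elements of $K$. The convex hull $[P]$ of $P\subseteq V$ is the smallest convex set containing $P$. The game $\mathrm{TER}(G)$: positions are the sets $P\subseteq V$ reachable from the starting position $\emptyset$ by the following moves. If $[V\setminus P]=V$, then the options of $P$ are all sets $P\cup\{v\}$ with $v\in V\setminus P$; if $[V\setminus P]\neq V$, then $P$ is terminal (has no options). The nim-value of a position is defined recursively by $\operatorname{nim}(p)=\operatorname{mex}\{\operatorname{nim}(q): q\text{ an option of }p\}$, where $\operatorname{mex}(A)$ is the smallest nonnegative integer not in $A$; the nim-value of a game is that of its starting position. -}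

module Defs where

open import Data.Bool.Base using (if_then_else_; true)
import Data.Bool.Properties as Bool
open import Data.Fin.Base using (Fin; zero; suc; toℕ)
open import Data.Fin.Properties using (_≟_; all?; any?; injective⇒≤; nonZeroIndex; toℕ<n)
open import Data.Fin.Subset using (Subset; _∈_; _⊆_; _⊃_; ∁; _∪_; ⁅_⁆; ⊤; ⊥)
open import Data.Fin.Subset.Induction using (⊃-wellFounded)
open import Data.Fin.Subset.Properties
  using (_∈?_; _⊆?_; anySubset?; p⊆p∪q; q⊆p∪q; x∈⁅x⁆)
open import Data.List.Base using (List; []; _∷_; allFin; filter; head; last; length; lookup; map)
open import Data.List.Extrema.Nat using (max; xs≤max)
open import Data.List.Membership.DecPropositional using () renaming (_∈?_ to memberOf?)
import Data.List.Membership.Propositional as List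
open import Data.List.Membership.Propositional.Properties
  using (mapWith∈≗map; mapWith∈-cong; ∈-map⁻; ∈-filter⁻; ∈-lookup)
open import Data.List.Relation.Unary.All using () renaming (lookup to All-lookup)
open import Data.List.Relation.Unary.AllPairs using ([]; _∷_)
open import Data.List.Relation.Unary.Linked using (Linked; linked?)
import Data.List.Relation.Unary.Unique.DecPropositional as DecUnique
open import Data.List.Relation.Unary.Unique.Propositional using (Unique)
open import Data.Maybe.Base using (just)
import Data.Maybe.Properties as Maybe
open import Data.Nat.Base as ℕ using (ℕ; zero; suc; _≤_; _<_; z≤n; s≤s)
open import Data.Nat.DivMod using (_%_; m<n⇒m%n≡m; n%n≡0)
import Data.Nat.Properties as ℕ
open import Data.Product.Base using (∃; _×_; _,_; proj₁; proj₂)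
open import Data.Sum.Base using (_⊎_; inj₁; inj₂; swap; reduce)
open import Data.Vec.Base using (tabulate)
open import Data.Vec.Properties using (lookup∘tabulate; lookup⇒[]=; []=⇒lookup; ≡-dec)
open import Function.Base using (_∘_)
open import Induction.WellFounded using (WellFounded; module All; module FixPoint; module Subrelation)
open import Relation.Binary.Definitions using (Decidable; Irreflexive; Symmetric)
open import Relation.Binary.PropositionalEquality
  using (_≡_; refl; sym; trans; cong; subst)
open import Relation.Nullary using (¬_; Dec; yes; no; does; contradiction)
open import Relation.Nullary.Decidable
  using (_×-dec_; _⊎-dec_; _→-dec_; ¬?; map′; dec-true; decidable-stable)
import Relation.Unary as U

mexSearch : ∀ (xs : List ℕ) fuel k → max 0 xs < fuel ℕ.+ k →
            (∀ {j} → j < k → j List.∈ xs) →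
            ∃ λ m → m List.∉ xs × (∀ {j} → j < m → j List.∈ xs)
mexSearch xs zero k max<k below =
  k , (λ k∈xs → ℕ.<⇒≱ max<k (All-lookup (xs≤max 0 xs) k∈xs)) , below
mexSearch xs (suc fuel) k max<k below with memberOf? ℕ._≟_ k xs
... | no k∉xs  = k , k∉xs , below
... | yes k∈xs = mexSearch xs fuel (suc k)
                   (subst (max 0 xs <_) (sym (ℕ.+-suc fuel k)) max<k) below′
  where
  below′ : ∀ {j} → j < suc k → j List.∈ xs
  below′ j<1+k with ℕ.m<1+n⇒m<n∨m≡n j<1+k
  ... | inj₁ j<k  = below j<k
  ... | inj₂ refl = k∈xs

mex-spec : ∀ xs → ∃ λ m → m List.∉ xs × (∀ {j} → j < m → j List.∈ xs)
mex-spec xs = mexSearch xs (suc (max 0 xs)) 0 (s≤s (ℕ.m≤m+n _ 0)) λ ()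

mex : List ℕ → ℕ
mex xs = proj₁ (mex-spec xs)

mex-∉ : ∀ xs → mex xs List.∉ xs
mex-∉ xs = proj₁ (proj₂ (mex-spec xs))

mex-least : ∀ xs {j} → j < mex xs → j List.∈ xs
mex-least xs = proj₂ (proj₂ (mex-spec xs))

-- The positions of the game proper are the elements of Position
-- reachable from start; unreachable elements do not influence the
-- nim-value of start.
record ImpartialGame : Set₁ where
  field
    Position    : Set
    start       : Position
    options     : Position → List Position
    wellFounded : WellFounded (λ q p → q List.∈ options p)

module _ (G : ImpartialGame) where
  open ImpartialGame G

  private
    step : ∀ p → (∀ {q} → q List.∈ options p → ℕ) → ℕ
    step p rec = mex (List.mapWith∈ (options p) rec)

  nimPosition : Position → ℕ
  nimPosition = All.wfRec wellFounded _ (λ _ → ℕ) step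

  nimPosition-mex : ∀ p → nimPosition p ≡ mex (map nimPosition (options p))
  nimPosition-mex p = trans
    (FixPoint.unfold-wfRec wellFounded (λ _ → ℕ) step
      (λ x eq → cong mex (mapWith∈-cong (options x) _ _ eq)))
    (cong mex (mapWith∈≗map nimPosition (options p)))

  nim : ℕ
  nim = nimPosition start

record SimpleGraph (n : ℕ) : Set₁ where
  field
    _~_    : Fin n → Fin n → Set
    ~-sym  : Symmetric _~_
    ~-irr  : Irreflexive _≡_ _~_
    _~?_   : Decidable _~_

private
  lookup-injective : ∀ {A : Set} {xs : List A} → Unique xs →
                     ∀ {i j} → lookup xs i ≡ lookup xs j → i ≡ j
  lookup-injective (_ ∷ _)  {zero}  {zero}  _  = refl
  lookup-injective (x∉ ∷ _) {zero}  {suc j} eq =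
    contradiction eq (All-lookup x∉ (∈-lookup j))
  lookup-injective (x∉ ∷ _) {suc i} {zero}  eq =
    contradiction (sym eq) (All-lookup x∉ (∈-lookup i))
  lookup-injective (_ ∷ u)  {suc i} {suc j} eq = cong suc (lookup-injective u eq)

  unique⇒length≤ : ∀ {n} {xs : List (Fin n)} → Unique xs → length xs ≤ n
  unique⇒length≤ u = injective⇒≤ (lookup-injective u)

  fromDoes : ∀ {A : Set} (a? : Dec A) → does a? ≡ true → A
  fromDoes (yes a) _ = a

  anyBoundedList? : ∀ {n} b {P : List (Fin n) → Set} → U.Decidable P →
                    Dec (∃ λ xs → length xs ≤ b × P xs)
  anyBoundedList? zero P? =
    map′ (λ p → [] , z≤n , p) (λ { ([] , _ , p) → p }) (P? [])
  anyBoundedList? (suc b) P? =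
    map′ (λ { (inj₁ p)                  → [] , z≤n , p
            ; (inj₂ (x , xs , len , p)) → x ∷ xs , s≤s len , p })
         (λ { ([] , _ , p)              → inj₁ p
            ; (x ∷ xs , s≤s len , p)    → inj₂ (x , xs , len , p) })
         (P? [] ⊎-dec any? (λ x → anyBoundedList? b (P? ∘ (x ∷_))))

module Convexity {n} (G : SimpleGraph n) where
  open SimpleGraph G

  -- A path is represented by the list of its vertices.
  IsPath : Fin n → Fin n → List (Fin n) → Set
  IsPath u v xs = head xs ≡ just u × last xs ≡ just v × Linked _~_ xs × Unique xs

  -- The length of a path is one less than its number of vertices, so
  -- numbers of vertices may be compared instead.
  IsShortestPath : Fin n → Fin n → List (Fin n) → Set
  IsShortestPath u v xs =
    IsPath u v xs × (∀ ys → IsPath u v ys → length xs ≤ length ys)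

  OnShortestPath : Fin n → Fin n → Fin n → Set
  OnShortestPath u v w = ∃ λ xs → IsShortestPath u v xs × w List.∈ xs

  Convex : Subset n → Set
  Convex K = ∀ u v w → u ∈ K → v ∈ K → OnShortestPath u v w → w ∈ K

  isPath? : ∀ u v → U.Decidable (IsPath u v)
  isPath? u v xs =
    Maybe.≡-dec _≟_ (head xs) (just u) ×-dec
    Maybe.≡-dec _≟_ (last xs) (just v) ×-dec
    linked? _~?_ xs ×-dec
    DecUnique.unique? _≟_ xs

  private
    path-length≤ : ∀ {u v xs} → IsPath u v xs → length xs ≤ n
    path-length≤ (_ , _ , _ , u) = unique⇒length≤ u

  isShortestPath? : ∀ u v → U.Decidable (IsShortestPath u v)
  isShortestPath? u v xs = isPath? u v xs ×-dec
    map′ (λ ∄ ys p → ℕ.≮⇒≥ λ ys<xs → ∄ (ys , path-length≤ p , p , ys<xs))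
         (λ { xs≤ (ys , _ , p , ys<xs) → ℕ.<⇒≱ ys<xs (xs≤ ys p) })
         (¬? (anyBoundedList? n (λ ys → isPath? u v ys ×-dec length ys ℕ.<? length xs)))

  onShortestPath? : ∀ u v w → Dec (OnShortestPath u v w)
  onShortestPath? u v w =
    map′ (λ { (xs , _ , p) → xs , p })
         (λ { (xs , s , w∈) → xs , path-length≤ (proj₁ s) , s , w∈ })
         (anyBoundedList? n (λ xs → isShortestPath? u v xs ×-dec memberOf? _≟_ w xs))

  convex? : U.Decidable Convex
  convex? K = all? λ u → all? λ v → all? λ w →
    (u ∈? K) →-dec ((v ∈? K) →-dec (onShortestPath? u v w →-dec (w ∈? K)))

  InEveryConvexSuperset : Subset n → Fin n → Set
  InEveryConvexSuperset P v = ∀ K → Convex K → P ⊆ K → v ∈ K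

  inEveryConvexSuperset? : ∀ P v → Dec (InEveryConvexSuperset P v)
  inEveryConvexSuperset? P v =
    map′ (λ ∄ K c P⊆K → decidable-stable (v ∈? K) λ v∉K → ∄ (K , c , (λ {x} → P⊆K {x}) , v∉K))
         (λ { every (K , c , P⊆K , v∉K) → v∉K (every K c P⊆K) })
         (¬? (anySubset? λ K → convex? K ×-dec (P ⊆? K) ×-dec ¬? (v ∈? K)))

  hull : Subset n → Subset n
  hull P = tabulate (does ∘ inEveryConvexSuperset? P)

  ∈-hull⁺ : ∀ {P v} → InEveryConvexSuperset P v → v ∈ hull P
  ∈-hull⁺ {P} {v} every = lookup⇒[]= v (hull P)
    (trans (lookup∘tabulate _ v) (dec-true (inEveryConvexSuperset? P v) every))

  ∈-hull⁻ : ∀ {P v} → v ∈ hull P → InEveryConvexSuperset P v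
  ∈-hull⁻ {P} {v} v∈ = fromDoes (inEveryConvexSuperset? P v)
    (trans (sym (lookup∘tabulate (does ∘ inEveryConvexSuperset? P) v)) ([]=⇒lookup v∈))

  hull-convex : ∀ P → Convex (hull P)
  hull-convex P u v w u∈ v∈ w-on = ∈-hull⁺ λ K c P⊆K →
    c u v w (∈-hull⁻ u∈ K c P⊆K) (∈-hull⁻ v∈ K c P⊆K) w-on

  ⊆-hull : ∀ P → P ⊆ hull P
  ⊆-hull P x∈P = ∈-hull⁺ λ K _ P⊆K → P⊆K x∈P

  hull-least : ∀ P K → Convex K → P ⊆ K → hull P ⊆ K
  hull-least P K c P⊆K x∈ = ∈-hull⁻ x∈ K c P⊆K

module _ {n} (G : SimpleGraph n) where
  open Convexity G

  terOptions : Subset n → List (Subset n)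
  terOptions P =
    if does (≡-dec Bool._≟_ (hull (∁ P)) ⊤)
    then map (λ v → P ∪ ⁅ v ⁆) (filter (λ v → ¬? (v ∈? P)) (allFin n))
    else []

  private
    option⇒⊃ : ∀ {Q P} → Q List.∈ terOptions P → Q ⊃ P
    option⇒⊃ {Q} {P} Q∈ with ≡-dec Bool._≟_ (hull (∁ P)) ⊤
    ... | yes _ with ∈-map⁻ (λ v → P ∪ ⁅ v ⁆) Q∈
    ...   | v , v∈ , refl =
      p⊆p∪q ⁅ v ⁆ , v , q⊆p∪q P ⁅ v ⁆ (x∈⁅x⁆ v) ,
      proj₂ (∈-filter⁻ (λ v → ¬? (v ∈? P)) {xs = allFin n} v∈)
    option⇒⊃ () | no _

  TER : ImpartialGame
  TER = record
    { Position    = Subset n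
    ; start       = ⊥
    ; options     = terOptions
    ; wellFounded = Subrelation.wellFounded option⇒⊃ ⊃-wellFounded
    }

-- Vertices are numbered from 0, so that toℕ ranges over the residues
-- modulo n.
data _⋯_ {n} (i j : Fin n) : Set where
  next : toℕ j ≡ _%_ (suc (toℕ i)) n ⦃ nonZeroIndex i ⦄ → i ⋯ j

private
  next? : ∀ {n} → Decidable (_⋯_ {n})
  next? {n} i j = map′ next (λ { (next eq) → eq })
    (toℕ j ℕ.≟ _%_ (suc (toℕ i)) n ⦃ nonZeroIndex i ⦄)

cycle : ∀ n → 3 ≤ n → SimpleGraph n
cycle n 3≤n = record
  { _~_   = λ i j → i ⋯ j ⊎ j ⋯ i
  ; ~-sym = swap
  ; ~-irr = λ { {i} refl → ¬next-self i ∘ reduce }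
  ; _~?_  = λ i j → next? i j ⊎-dec next? j i
  }
  where
  ¬next-self : (i : Fin n) → ¬ (i ⋯ i)
  ¬next-self i (next eq) with ℕ.m≤n⇒m<n∨m≡n (toℕ<n i)
  ... | inj₁ 1+i<n = ℕ.1+n≢n (sym (trans eq (m<n⇒m%n≡m ⦃ nonZeroIndex i ⦄ 1+i<n)))
  ... | inj₂ 1+i≡n = ℕ.<⇒≢ (ℕ.<-≤-trans (s≤s (s≤s z≤n)) 3≤n) (trans (cong suc (sym i≡0)) 1+i≡n)
    where
    i≡0 : toℕ i ≡ 0
    i≡0 = trans eq (trans (cong (λ m → _%_ m n ⦃ nonZeroIndex i ⦄) 1+i≡n)
                          (n%n≡0 n ⦃ nonZeroIndex i ⦄))

{-# OPTIONS --safe #-}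

-- A set of vertices of C₂ₖ spans the cycle as soon as it contains an
-- antipodal pair, while two vertices that are not antipodal lie in a half
-- cycle, which is convex.  The second player wins by answering v with the
-- antipode of v, which keeps the position symmetric, so that any move of the
-- first player leaves an antipodal pair unselected.  Only when two antipodal
-- pairs {v , v′} and {w , w′} are left does the answer to v change: it is then
-- w, which leaves v′ and w′ and ends the game.
module Submission where

open import Defs
import Data.Bool.Properties as Bool
open import Data.Fin.Base using (Fin; toℕ; fromℕ<)
open import Data.Fin.Properties using (_≟_; any?; toℕ<n; toℕ-injective; toℕ-fromℕ<)
open import Data.Fin.Subset using (Subset; _∈_; _∉_; _⊆_; _⊃_; ∁; _∪_; ⁅_⁆; ⊤; ⊥)
open import Data.Fin.Subset.Induction using (⊃-wellFounded; Acc; acc)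
open import Data.Fin.Subset.Properties
  using (_∈?_; ∈⊤; ∉⊥; ⊆⊤; ⊆-antisym; x∈⁅x⁆; x∈⁅y⁆⇒x≡y; x∈p∪q⁻; ∪-assoc; p⊆p∪q; q⊆p∪q; x∈∁p⇒x∉p; x∉p⇒x∈∁p)
open import Data.List.Base using (List; []; _∷_; allFin; applyUpTo; last; length; map)
import Data.List.Membership.Propositional as List
open import Data.List.Membership.Propositional.Properties
  using (∈-allFin; ∈-applyUpTo⁺; ∈-filter⁺; ∈-filter⁻; ∈-map⁺; ∈-map⁻)
open import Data.List.Properties using (length-applyUpTo)
open import Data.List.Relation.Unary.Any using (here; there)
open import Data.List.Relation.Unary.Linked using (Linked; [-]; _∷_)
import Data.List.Relation.Unary.Linked.Properties as Linked
import Data.List.Relation.Unary.Unique.Propositional.Properties as Unique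
open import Data.Maybe.Base using (just)
open import Data.Maybe.Properties using (just-injective)
open import Data.Nat.Base
  using (ℕ; zero; suc; _+_; _*_; _∸_; _⊓_; ∣_-_∣; _≤_; _<_; z≤n; s≤s; s≤s⁻¹; NonZero; >-nonZero)
open import Data.Nat.Divisibility using (_∣_; divides)
open import Data.Nat.DivMod
  using (_%_; _mod_; m%n<n; m%n%n≡m%n; m<n⇒m%n≡m; n%n≡0; %-distribˡ-+; [m+n]%n≡m%n)
open import Data.Nat.Properties hiding (_≟_)
open import Data.Product.Base using (∃; _×_; _,_; proj₂; swap)
open import Data.Sum.Base using (_⊎_; inj₁; inj₂; [_,_]′) renaming (map to ⊎-map)
open import Data.Vec.Base using (tabulate)
open import Data.Vec.Properties using (lookup∘tabulate; lookup⇒[]=; []=⇒lookup; ≡-dec)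
open import Function.Base using (_∘_; _$_)
open import Relation.Binary.Definitions using (tri<; tri≈; tri>)
open import Relation.Binary.PropositionalEquality
  using (_≡_; _≢_; refl; sym; trans; cong; cong₂; subst; subst₂; module ≡-Reasoning)
open import Relation.Nullary using (¬_; Dec; yes; no; does; contradiction)
open import Relation.Nullary.Decidable using (_×-dec_; ¬?; dec-true; dec-false)
import Relation.Unary as U

-- Zero and nonzero nim-values.

module _ (G : ImpartialGame) where
  open ImpartialGame G

  -- A positive mex would have 0 among the values of the options.
  nimPosition≡0 : ∀ p → (∀ {q} → q List.∈ options p → nimPosition G q ≢ 0) → nimPosition G p ≡ 0
  nimPosition≡0 p all≢0 with nimPosition G p in eq
  ... | zero  = refl
  ... | suc m
    with q , q∈ , 0≡ ← ∈-map⁻ (nimPosition G) (mex-least (map (nimPosition G) (options p))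
                         (subst (0 <_) (trans (sym eq) (nimPosition-mex G p)) (s≤s z≤n)))
    = contradiction (sym 0≡) (all≢0 q∈)

  nimPosition≢0 : ∀ {p q} → q List.∈ options p → nimPosition G q ≡ 0 → nimPosition G p ≢ 0
  nimPosition≢0 {p} q∈ q≡0 p≡0 = mex-∉ (map (nimPosition G) (options p)) $
    subst (List._∈ map (nimPosition G) (options p))
      (trans q≡0 (trans (sym p≡0) (nimPosition-mex G p)))
      (∈-map⁺ (nimPosition G) q∈)

-- Moves of the game, and paths given by an indexing function.

module _ {n} (G : SimpleGraph n) where
  open Convexity G

  terOptions⁺ : ∀ {P v} → hull (∁ P) ≡ ⊤ → v ∉ P → (P ∪ ⁅ v ⁆) List.∈ terOptions G P
  terOptions⁺ {P} {v} spans v∉P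
    rewrite dec-true (≡-dec Bool._≟_ (hull (∁ P)) ⊤) spans =
    ∈-map⁺ (λ v → P ∪ ⁅ v ⁆) (∈-filter⁺ (λ v → ¬? (v ∈? P)) (∈-allFin v) v∉P)

  terOptions⁻ : ∀ {P Q} → Q List.∈ terOptions G P → ∃ λ v → v ∉ P × Q ≡ P ∪ ⁅ v ⁆
  terOptions⁻ {P} Q∈ with ≡-dec Bool._≟_ (hull (∁ P)) ⊤
  ... | yes _ with v , v∈ , eq ← ∈-map⁻ (λ v → P ∪ ⁅ v ⁆) Q∈ =
    v , proj₂ (∈-filter⁻ (λ v → ¬? (v ∈? P)) {xs = allFin n} v∈) , eq
  terOptions⁻ () | no _

  terminal⇒nimPosition≡0 : ∀ {P} → hull (∁ P) ≢ ⊤ → nimPosition (TER G) P ≡ 0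
  terminal⇒nimPosition≡0 {P} ¬spans = nimPosition≡0 (TER G) P λ {q} q∈ →
    contradiction (subst (q List.∈_) options≡[] q∈) λ ()
    where
    options≡[] : terOptions G P ≡ []
    options≡[] rewrite dec-false (≡-dec Bool._≟_ (hull (∁ P)) ⊤) ¬spans = refl

  open SimpleGraph G

  applyUpTo-isPath : ∀ (p : ℕ → Fin n) m →
                     (∀ {i} → i < m → p i ~ p (suc i)) →
                     (∀ {i j} → i < j → j ≤ m → p i ≢ p j) →
                     IsPath (p 0) (p m) (applyUpTo p (suc m))
  applyUpTo-isPath p m adj inj =
    refl , last-applyUpTo p m ,
    Linked.applyUpTo⁺₁ p (suc m) (adj ∘ s≤s⁻¹) ,
    Unique.applyUpTo⁺₁ p (suc m) (λ i<j j<1+m → inj i<j (s≤s⁻¹ j<1+m))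
    where
    last-applyUpTo : ∀ (p : ℕ → Fin n) m → last (applyUpTo p (suc m)) ≡ just (p m)
    last-applyUpTo p zero    = refl
    last-applyUpTo p (suc m) = last-applyUpTo (p ∘ suc) m

last-∈ : ∀ {A : Set} (xs : List A) {v} → last xs ≡ just v → v List.∈ xs
last-∈ (x ∷ [])     eq = here (sym (just-injective eq))
last-∈ (x ∷ y ∷ xs) eq = there (last-∈ (y ∷ xs) eq)

module _ {n} {P : Fin n → Set} (P? : U.Decidable P) where

  ∈-tabulate⁺ : ∀ {x} → P x → x ∈ tabulate (does ∘ P?)
  ∈-tabulate⁺ {x} px = lookup⇒[]= x _ (trans (lookup∘tabulate _ x) (dec-true (P? x) px))

  ∈-tabulate⁻ : ∀ {x} → x ∈ tabulate (does ∘ P?) → P x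
  ∈-tabulate⁻ {x} x∈ with P? x | trans (sym (lookup∘tabulate (does ∘ P?) x)) ([]=⇒lookup x∈)
  ... | yes px | _ = px

-- Residue arithmetic and membership after a move.

[m%n+o]%n≡[m+o]%n : ∀ m o n .⦃ _ : NonZero n ⦄ → (m % n + o) % n ≡ (m + o) % n
[m%n+o]%n≡[m+o]%n m o n = begin
  (m % n + o) % n            ≡⟨ %-distribˡ-+ (m % n) o n ⟩
  (m % n % n + o % n) % n    ≡⟨ cong (λ r → (r + o % n) % n) (m%n%n≡m%n m n) ⟩
  (m % n + o % n) % n        ≡⟨ %-distribˡ-+ m o n ⟨
  (m + o) % n                ∎
  where open ≡-Reasoning

suc[m%n]%n≡suc[m]%n : ∀ m n .⦃ _ : NonZero n ⦄ → suc (m % n) % n ≡ suc m % n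
suc[m%n]%n≡suc[m]%n m n = begin
  suc (m % n) % n   ≡⟨ cong (_% n) (+-comm 1 (m % n)) ⟩
  (m % n + 1) % n   ≡⟨ [m%n+o]%n≡[m+o]%n m 1 n ⟩
  (m + 1) % n       ≡⟨ cong (_% n) (+-comm m 1) ⟩
  suc m % n         ∎
  where open ≡-Reasoning

∉-∪⁅⁆ : ∀ {n} {P : Subset n} {v w} → w ∉ P → w ≢ v → w ∉ P ∪ ⁅ v ⁆
∉-∪⁅⁆ {P = P} {v} w∉P w≢v w∈ = [ w∉P , w≢v ∘ x∈⁅y⁆⇒x≡y v ]′ (x∈p∪q⁻ P ⁅ v ⁆ w∈)

-- The pairing strategy for an arbitrary involution.

module Mirror {n} (antipode : Fin n → Fin n)
  (antipode-involutive : ∀ v → antipode (antipode v) ≡ v) where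

  Symmetric : Subset n → Set
  Symmetric P = ∀ {v} → v ∈ P → antipode v ∈ P

  antipode-∉ : ∀ {P} → Symmetric P → ∀ {v} → v ∉ P → antipode v ∉ P
  antipode-∉ {P} sym-P {v} v∉P v′∈P = v∉P (subst (_∈ P) (antipode-involutive v) (sym-P v′∈P))

  ∪-pair-symmetric : ∀ {P} v → Symmetric P → Symmetric (P ∪ ⁅ v ⁆ ∪ ⁅ antipode v ⁆)
  ∪-pair-symmetric {P} v sym-P u∈ with x∈p∪q⁻ P (⁅ v ⁆ ∪ ⁅ antipode v ⁆) u∈
  ... | inj₁ u∈P = p⊆p∪q (⁅ v ⁆ ∪ ⁅ antipode v ⁆) (sym-P u∈P)
  ... | inj₂ u∈v,v′ = q⊆p∪q P _ ([ on-v , on-v′ ]′ (x∈p∪q⁻ ⁅ v ⁆ ⁅ antipode v ⁆ u∈v,v′))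
    where
    on-v : ∀ {u} → u ∈ ⁅ v ⁆ → antipode u ∈ ⁅ v ⁆ ∪ ⁅ antipode v ⁆
    on-v u∈ with refl ← x∈⁅y⁆⇒x≡y v u∈ = q⊆p∪q ⁅ v ⁆ _ (x∈⁅x⁆ (antipode v))
    on-v′ : ∀ {u} → u ∈ ⁅ antipode v ⁆ → antipode u ∈ ⁅ v ⁆ ∪ ⁅ antipode v ⁆
    on-v′ u∈ with refl ← x∈⁅y⁆⇒x≡y (antipode v) u∈ = p⊆p∪q _
      (subst (_∈ ⁅ v ⁆) (sym (antipode-involutive v)) (x∈⁅x⁆ v))

  -- One member of each pair is recorded; when `P` is symmetric, the antipodes `antipode x` and
  -- `antipode y` are free as well.
  record TwoFreePairs (P : Subset n) : Set where
    constructor mk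
    field
      x y  : Fin n
      x∉P  : x ∉ P
      y∉P  : y ∉ P
      y≢x  : y ≢ x
      y≢x′ : y ≢ antipode x

  -- Whichever vertex `v` the first player takes, one of the two recorded pairs avoids it: `y`
  -- serves if `x` belongs to the pair of `v`, and `x` serves otherwise.
  second-free-pair : ∀ {P} → TwoFreePairs P → ∀ v → ∃ λ w → w ∉ P × w ≢ v × w ≢ antipode v
  second-free-pair (mk x y x∉P y∉P y≢x y≢x′) v with x ≟ v | x ≟ antipode v
  ... | yes refl | _        = y , y∉P , y≢x , y≢x′
  ... | no _     | yes refl = y , y∉P , (λ y≡v → y≢x′ (trans y≡v (sym (antipode-involutive v)))) , y≢x
  ... | no x≢v   | no x≢v′  = x , x∉P , x≢v , x≢v′

  -- This condition selects the reply: mirror the move if it holds, end the game if it fails.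
  ThirdFreePair : Subset n → Fin n → Fin n → Set
  ThirdFreePair P v w = ∃ λ z → z ∉ P × z ≢ v × z ≢ antipode v × z ≢ w × z ≢ antipode w

  thirdFreePair? : ∀ P v w → Dec (ThirdFreePair P v w)
  thirdFreePair? P v w = any? λ z →
    ¬? (z ∈? P) ×-dec ¬? (z ≟ v) ×-dec ¬? (z ≟ antipode v) ×-dec ¬? (z ≟ w) ×-dec ¬? (z ≟ antipode w)

  antipodes-left : ∀ {P v w} → ¬ ThirdFreePair P v w →
                   ∀ {z} → z ∉ (P ∪ ⁅ v ⁆) ∪ ⁅ w ⁆ → z ≡ antipode v ⊎ z ≡ antipode w
  antipodes-left {P} {v} {w} ∄third {z} z∉ with z ≟ antipode v | z ≟ antipode w
  ... | yes eq  | _       = inj₁ eq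
  ... | no _    | yes eq  = inj₂ eq
  ... | no z≢v′ | no z≢w′ = contradiction
    ( z
    , (λ z∈P → z∉ (p⊆p∪q ⁅ w ⁆ (p⊆p∪q ⁅ v ⁆ z∈P)))
    , (λ { refl → z∉ (p⊆p∪q ⁅ w ⁆ (q⊆p∪q P ⁅ v ⁆ (x∈⁅x⁆ v))) })
    , z≢v′
    , (λ { refl → z∉ (q⊆p∪q (P ∪ ⁅ v ⁆) ⁅ w ⁆ (x∈⁅x⁆ w)) })
    , z≢w′) ∄third

  module Strategy (G : SimpleGraph n)
    (antipode-≢ : ∀ v → antipode v ≢ v)
    (antipodal-pair-spans : ∀ {S v} → v ∈ S → antipode v ∈ S → Convexity.hull G S ≡ ⊤)
    (pair-¬spans : ∀ {S x y} → y ≢ antipode x →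
                   (∀ {z} → z ∈ S → z ≡ x ⊎ z ≡ y) → Convexity.hull G S ≢ ⊤)
    where

    open Convexity G using (hull)

    -- Induction along growing positions. Every option has nonzero value because it has in turn an
    -- option of value 0: either a larger symmetric position with two free pairs, or a terminal one.
    symmetric-nim≡0 : ∀ {P} → Acc _⊃_ P → Symmetric P → TwoFreePairs P → nimPosition (TER G) P ≡ 0
    symmetric-nim≡0 {P} (acc rec) sym-P free =
      nimPosition≡0 (TER G) P λ Q∈ → reply-to (terOptions⁻ G Q∈)
      where
      reply : ∀ {v w} → v ∉ P → w ∉ P → w ≢ v → w ≢ antipode v → nimPosition (TER G) (P ∪ ⁅ v ⁆) ≢ 0
      reply {v} {w} v∉P w∉P w≢v w≢v′ = answer (thirdFreePair? P v w)
        where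
        v′ = antipode v
        w′ = antipode w
        Q = P ∪ ⁅ v ⁆

        v′∉P : v′ ∉ P
        v′∉P = antipode-∉ sym-P v∉P
        w′∉P : w′ ∉ P
        w′∉P = antipode-∉ sym-P w∉P
        w′≢v : w′ ≢ v
        w′≢v eq = w≢v′ (trans (sym (antipode-involutive w)) (cong antipode eq))
        w′≢v″ : w′ ≢ antipode v′
        w′≢v″ eq = w′≢v (trans eq (antipode-involutive v))

        -- The pair of `w` is untouched by `v`, so `Q` is not terminal and a reply is allowed.
        Q-spans : hull (∁ Q) ≡ ⊤
        Q-spans = antipodal-pair-spans
          (x∉p⇒x∈∁p (∉-∪⁅⁆ w∉P w≢v)) (x∉p⇒x∈∁p (∉-∪⁅⁆ w′∉P w′≢v))

        answer : Dec (ThirdFreePair P v w) → nimPosition (TER G) Q ≢ 0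
        answer (yes (z , z∉P , z≢v , z≢v′ , z≢w , z≢w′)) =
          -- Reply with `v′`; the pairs of `w` and `z` then witness that two free pairs remain.
          nimPosition≢0 (TER G) (terOptions⁺ G Q-spans (∉-∪⁅⁆ v′∉P (antipode-≢ v)))
            (symmetric-nim≡0 (rec Q′⊃P)
              (subst Symmetric (sym (∪-assoc P ⁅ v ⁆ ⁅ v′ ⁆)) (∪-pair-symmetric v sym-P))
              (mk w z (∉-∪⁅⁆ (∉-∪⁅⁆ w∉P w≢v) w≢v′) (∉-∪⁅⁆ (∉-∪⁅⁆ z∉P z≢v) z≢v′) z≢w z≢w′))
          where
          Q′⊃P : (Q ∪ ⁅ v′ ⁆) ⊃ P
          Q′⊃P = p⊆p∪q ⁅ v′ ⁆ ∘ p⊆p∪q ⁅ v ⁆ , v , p⊆p∪q ⁅ v′ ⁆ (q⊆p∪q P ⁅ v ⁆ (x∈⁅x⁆ v)) , v∉P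
        answer (no ∄third) =
          -- Reply with `w`. Only `v′` and `w′` can remain, and they are not antipodal since
          -- `antipode v′` is `v`, so the position reached is terminal.
          nimPosition≢0 (TER G) (terOptions⁺ G Q-spans (∉-∪⁅⁆ w∉P w≢v))
            (terminal⇒nimPosition≡0 G (pair-¬spans w′≢v″ λ z∈ → antipodes-left ∄third (x∈∁p⇒x∉p z∈)))

      reply-to : ∀ {Q} → (∃ λ v → v ∉ P × Q ≡ P ∪ ⁅ v ⁆) → nimPosition (TER G) Q ≢ 0
      reply-to (v , v∉P , refl) =
        let w , w∉P , w≢v , w≢v′ = second-free-pair free v in reply v∉P w∉P w≢v w≢v′

    nim≡0 : TwoFreePairs ⊥ → nim (TER G) ≡ 0
    nim≡0 = symmetric-nim≡0 (⊃-wellFounded ⊥) (λ v∈ → contradiction v∈ ∉⊥)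

-- Rotations and offsets on the cycle.

module _ {n} .⦃ _ : NonZero n ⦄ where

  infixl 6 _⊞_

  _⊞_ : Fin n → ℕ → Fin n
  a ⊞ i = (toℕ a + i) mod n

  -- The number of forward steps from `a` to `x`. The term `n ∸ toℕ a` stands for minus `a` modulo
  -- `n`, which avoids truncated subtraction of `a` from `x`.
  offset : Fin n → Fin n → ℕ
  offset a x = (toℕ x + (n ∸ toℕ a)) % n

  toℕ-⊞ : ∀ a i → toℕ (a ⊞ i) ≡ (toℕ a + i) % n
  toℕ-⊞ a i = toℕ-fromℕ< (m%n<n (toℕ a + i) n)

  offset<n : ∀ a x → offset a x < n
  offset<n a x = m%n<n (toℕ x + (n ∸ toℕ a)) n

  offset-⊞ : ∀ a {i} → i < n → offset a (a ⊞ i) ≡ i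
  offset-⊞ a {i} i<n = begin
    (toℕ (a ⊞ i) + (n ∸ toℕ a)) % n         ≡⟨ cong (λ m → (m + (n ∸ toℕ a)) % n) (toℕ-⊞ a i) ⟩
    ((toℕ a + i) % n + (n ∸ toℕ a)) % n     ≡⟨ [m%n+o]%n≡[m+o]%n (toℕ a + i) (n ∸ toℕ a) n ⟩
    (toℕ a + i + (n ∸ toℕ a)) % n           ≡⟨ cong (λ m → (m + (n ∸ toℕ a)) % n) (+-comm (toℕ a) i) ⟩
    (i + toℕ a + (n ∸ toℕ a)) % n           ≡⟨ cong (_% n) (+-assoc i (toℕ a) (n ∸ toℕ a)) ⟩
    (i + (toℕ a + (n ∸ toℕ a))) % n         ≡⟨ cong (λ m → (i + m) % n) (m+[n∸m]≡n (<⇒≤ (toℕ<n a))) ⟩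
    (i + n) % n                             ≡⟨ [m+n]%n≡m%n i n ⟩
    i % n                                   ≡⟨ m<n⇒m%n≡m i<n ⟩
    i                                       ∎
    where open ≡-Reasoning

  ⊞-offset : ∀ a x → a ⊞ offset a x ≡ x
  ⊞-offset a x = toℕ-injective $ begin
    toℕ (a ⊞ offset a x)                        ≡⟨ toℕ-⊞ a (offset a x) ⟩
    (toℕ a + offset a x) % n                    ≡⟨ cong (_% n) (+-comm (toℕ a) (offset a x)) ⟩
    (offset a x + toℕ a) % n                    ≡⟨ [m%n+o]%n≡[m+o]%n (toℕ x + (n ∸ toℕ a)) (toℕ a) n ⟩
    (toℕ x + (n ∸ toℕ a) + toℕ a) % n           ≡⟨ cong (_% n) (+-assoc (toℕ x) (n ∸ toℕ a) (toℕ a)) ⟩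
    (toℕ x + (n ∸ toℕ a + toℕ a)) % n           ≡⟨ cong (λ m → (toℕ x + m) % n) (m∸n+n≡m (<⇒≤ (toℕ<n a))) ⟩
    (toℕ x + n) % n                             ≡⟨ [m+n]%n≡m%n (toℕ x) n ⟩
    toℕ x % n                                   ≡⟨ m<n⇒m%n≡m (toℕ<n x) ⟩
    toℕ x                                       ∎
    where open ≡-Reasoning

  ⊞-assoc : ∀ a i j → a ⊞ i ⊞ j ≡ a ⊞ (i + j)
  ⊞-assoc a i j = toℕ-injective $ begin
    toℕ (a ⊞ i ⊞ j)              ≡⟨ toℕ-⊞ (a ⊞ i) j ⟩
    (toℕ (a ⊞ i) + j) % n        ≡⟨ cong (λ m → (m + j) % n) (toℕ-⊞ a i) ⟩
    ((toℕ a + i) % n + j) % n    ≡⟨ [m%n+o]%n≡[m+o]%n (toℕ a + i) j n ⟩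
    (toℕ a + i + j) % n          ≡⟨ cong (_% n) (+-assoc (toℕ a) i j) ⟩
    (toℕ a + (i + j)) % n        ≡⟨ toℕ-⊞ a (i + j) ⟨
    toℕ (a ⊞ (i + j))            ∎
    where open ≡-Reasoning

  ⊞-n : ∀ a → a ⊞ n ≡ a
  ⊞-n a = toℕ-injective $
    trans (toℕ-⊞ a n) (trans ([m+n]%n≡m%n (toℕ a) n) (m<n⇒m%n≡m (toℕ<n a)))

  ⊞-0 : ∀ a → a ⊞ 0 ≡ a
  ⊞-0 a = toℕ-injective $
    trans (toℕ-⊞ a 0) (trans (cong (_% n) (+-identityʳ (toℕ a))) (m<n⇒m%n≡m (toℕ<n a)))

  ⊞-injective : ∀ a {i j} → i < n → j < n → a ⊞ i ≡ a ⊞ j → i ≡ j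
  ⊞-injective a i<n j<n eq =
    trans (sym (offset-⊞ a i<n)) (trans (cong (offset a) eq) (offset-⊞ a j<n))

  ⊞-⋯ : ∀ a i → (a ⊞ i) ⋯ (a ⊞ suc i)
  ⊞-⋯ a i = next toℕ≡
    where
    open ≡-Reasoning
    -- Here `_%_` uses the instance in scope, while `next` uses `nonZeroIndex`; the two agree
    -- because that argument of `_%_` is irrelevant.
    toℕ≡ : toℕ (a ⊞ suc i) ≡ suc (toℕ (a ⊞ i)) % n
    toℕ≡ = begin
      toℕ (a ⊞ suc i)              ≡⟨ toℕ-⊞ a (suc i) ⟩
      (toℕ a + suc i) % n          ≡⟨ cong (_% n) (+-suc (toℕ a) i) ⟩
      suc (toℕ a + i) % n          ≡⟨ suc[m%n]%n≡suc[m]%n (toℕ a + i) n ⟨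
      suc ((toℕ a + i) % n) % n    ≡⟨ cong (λ m → suc m % n) (toℕ-⊞ a i) ⟨
      suc (toℕ (a ⊞ i)) % n        ∎

  offset-⋯ : ∀ a {x y} → x ⋯ y → offset a y ≡ suc (offset a x) % n
  offset-⋯ a {x} {y} (next eq) = begin
    (toℕ y + (n ∸ toℕ a)) % n               ≡⟨ cong (λ m → (m + (n ∸ toℕ a)) % n) toℕ≡ ⟩
    (suc (toℕ x) % n + (n ∸ toℕ a)) % n     ≡⟨ [m%n+o]%n≡[m+o]%n (suc (toℕ x)) (n ∸ toℕ a) n ⟩
    suc (toℕ x + (n ∸ toℕ a)) % n           ≡⟨ suc[m%n]%n≡suc[m]%n (toℕ x + (n ∸ toℕ a)) n ⟨
    suc (offset a x) % n                    ∎
    where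
    open ≡-Reasoning
    toℕ≡ : toℕ y ≡ suc (toℕ x) % n
    toℕ≡ = eq

-- Folding the cycle onto a half.

-- The reflection c ↦ 2k - 1 - c folds the half {k , … , 2k - 1} of the cycle
-- onto the half {0 , … , k - 1}.  Both edges joining the two halves collapse.
fold : ℕ → ℕ → ℕ
fold k c = c ⊓ (k + k ∸ suc c)

fold-low : ∀ {k c} → c < k → fold k c ≡ c
fold-low {k} {c} c<k = m≤n⇒m⊓n≡m (m+n≤o⇒m≤o∸n c (+-mono-≤ (<⇒≤ c<k) c<k))

fold-high : ∀ {k c} → k ≤ c → fold k c ≡ k + k ∸ suc c
fold-high {k} {c} k≤c = m≥n⇒m⊓n≡n (m≤n+o⇒m∸n≤o (k + k) (suc c) (+-mono-≤ (m≤n⇒m≤1+n k≤c) k≤c))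

-- An edge that changes halves must fall under the first alternative, where `fold` stands still.
-- This wasted edge is what makes the bound for crossing walks strict.
FoldStep : ℕ → ℕ → ℕ → Set
FoldStep k c d = fold k c ≡ fold k d ⊎ (∣ fold k c - fold k d ∣ ≤ 1 × (c < k × d < k ⊎ k ≤ c × k ≤ d))

FoldStep-sym : ∀ {k c d} → FoldStep k c d → FoldStep k d c
FoldStep-sym (inj₁ eq) = inj₁ (sym eq)
FoldStep-sym {k} {c} {d} (inj₂ (le , sides)) =
  inj₂ (subst (_≤ 1) (∣-∣-comm (fold k c) (fold k d)) le ,
        ⊎-map swap swap sides)

∣n-1+n∣≡1 : ∀ n → ∣ n - suc n ∣ ≡ 1
∣n-1+n∣≡1 zero    = refl
∣n-1+n∣≡1 (suc n) = ∣n-1+n∣≡1 n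

foldStep : ∀ k {c} .⦃ _ : NonZero (k + k) ⦄ → 0 < k → c < k + k → FoldStep k c (suc c % (k + k))
foldStep k {c} 0<k c<n with m≤n⇒m<n∨m≡n c<n
-- The closing edge, from `2k - 1` back to `0`.
... | inj₂ 1+c≡n = inj₁ $ begin
    fold k c                        ≡⟨ fold-high k≤c ⟩
    k + k ∸ suc c                   ≡⟨ cong (k + k ∸_) 1+c≡n ⟩
    k + k ∸ (k + k)                 ≡⟨ n∸n≡0 (k + k) ⟩
    0                               ≡⟨ cong (fold k) (n%n≡0 (k + k)) ⟨
    fold k ((k + k) % (k + k))      ≡⟨ cong (λ m → fold k (m % (k + k))) 1+c≡n ⟨
    fold k (suc c % (k + k))        ∎
    where
    open ≡-Reasoning
    k≤c : k ≤ c
    k≤c = s≤s⁻¹ (subst (k <_) (sym 1+c≡n) (m<m+n k 0<k))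
... | inj₁ 1+c<n rewrite m<n⇒m%n≡m 1+c<n with suc c <? k | c <? k
...   | yes 1+c<k | _ = inj₂
    ( ≤-reflexive (trans (cong₂ ∣_-_∣ (fold-low (<⇒≤ 1+c<k)) (fold-low 1+c<k)) (∣n-1+n∣≡1 c))
    , inj₁ (<⇒≤ 1+c<k , 1+c<k))
-- The other collapsed edge, from `k - 1` to `k`; here `k` is `suc c`.
...   | no 1+c≮k | yes c<k with refl ← ≤-antisym c<k (≮⇒≥ 1+c≮k) = inj₁ $ begin
    fold (suc c) c                 ≡⟨ fold-low ≤-refl ⟩
    c                              ≡⟨ m+n∸n≡m c (suc c) ⟨
    suc c + suc c ∸ suc (suc c)    ≡⟨ fold-high ≤-refl ⟨
    fold (suc c) (suc c)           ∎
    where open ≡-Reasoning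
...   | no 1+c≮k | no c≮k = inj₂ (≤-reflexive gap , inj₂ (k≤c , m≤n⇒m≤1+n k≤c))
    where
    open ≡-Reasoning
    k≤c : k ≤ c
    k≤c = ≮⇒≥ c≮k
    gap : ∣ fold k c - fold k (suc c) ∣ ≡ 1
    gap = begin
      ∣ fold k c - fold k (suc c) ∣
        ≡⟨ cong₂ ∣_-_∣ (trans (fold-high k≤c) (+-∸-assoc 1 1+c<n)) (fold-high (m≤n⇒m≤1+n k≤c)) ⟩
      ∣ suc (k + k ∸ suc (suc c)) - (k + k ∸ suc (suc c)) ∣
        ≡⟨ ∣-∣-comm (suc (k + k ∸ suc (suc c))) (k + k ∸ suc (suc c)) ⟩
      ∣ (k + k ∸ suc (suc c)) - suc (k + k ∸ suc (suc c)) ∣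
        ≡⟨ ∣n-1+n∣≡1 (k + k ∸ suc (suc c)) ⟩
      1 ∎

4≤m+m⇒2≤m : ∀ m → 4 ≤ m + m → 2 ≤ m
4≤m+m⇒2≤m (suc (suc m)) _ = s≤s (s≤s z≤n)
4≤m+m⇒2≤m (suc zero) (s≤s (s≤s ()))

-- Distances in the even cycle, bounded below by folding.

module EvenCycle (k : ℕ) (4≤n : 4 ≤ k + k) where

  n : ℕ
  n = k + k

  G : SimpleGraph n
  G = cycle n (≤-trans (n≤1+n 3) 4≤n)

  open SimpleGraph G
  open Convexity G

  2≤k : 2 ≤ k
  2≤k = 4≤m+m⇒2≤m k 4≤n

  0<k : 0 < k
  0<k = <⇒≤ 2≤k

  k<n : k < n
  k<n = m<m+n k 0<k

  0<n : 0 < n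
  0<n = <-trans 0<k k<n

  instance
    n≢0 : NonZero n
    n≢0 = >-nonZero 0<n

  φ : Fin n → Fin n → ℕ
  φ a x = fold k (offset a x)

  foldStep-~ : ∀ a {x y} → x ~ y → FoldStep k (offset a x) (offset a y)
  foldStep-~ a {x} {y} (inj₁ x⋯y) =
    subst (FoldStep k (offset a x)) (sym (offset-⋯ a x⋯y)) (foldStep k 0<k (offset<n a x))
  foldStep-~ a {x} {y} (inj₂ y⋯x) = FoldStep-sym {k} {offset a y} $
    subst (FoldStep k (offset a y)) (sym (offset-⋯ a y⋯x)) (foldStep k 0<k (offset<n a y))

  ∣φ-φ∣≤1 : ∀ a {x y} → x ~ y → ∣ φ a x - φ a y ∣ ≤ 1
  ∣φ-φ∣≤1 a {x} {y} x~y with foldStep-~ a x~y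
  ... | inj₁ eq       = subst (_≤ 1) (sym (m≡n⇒∣m-n∣≡0 eq)) z≤n
  ... | inj₂ (le , _) = le

  -- Each edge changes `φ a` by at most 1, and `length xs` counts the edges of the walk on `x ∷ xs`.
  walk-bound : ∀ a x xs {v} → Linked _~_ (x ∷ xs) → last (x ∷ xs) ≡ just v →
               ∣ φ a x - φ a v ∣ ≤ length xs
  walk-bound a x []       [-]             refl = ≤-reflexive (∣n-n∣≡0 (φ a x))
  walk-bound a x (y ∷ xs) {v} (x~y ∷ walk) eq = ≤-trans
    (∣-∣-triangle (φ a x) (φ a y) (φ a v))
    (+-mono-≤ (∣φ-φ∣≤1 a x~y) (walk-bound a y xs walk eq))

  -- A walk leaving the half where it starts uses a collapsed edge. That edge adds to the length but
  -- not to the change of `φ a`. The induction runs up to the first such edge, after which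
  -- `walk-bound` suffices.
  crossing-walk-bound : ∀ a x xs {v w} → Linked _~_ (x ∷ xs) → last (x ∷ xs) ≡ just v →
                        offset a x < k → w List.∈ x ∷ xs → k ≤ offset a w →
                        ∣ φ a x - φ a v ∣ < length xs
  crossing-walk-bound a x xs       walk         eq x<k (here refl) k≤w = contradiction x<k (≤⇒≯ k≤w)
  crossing-walk-bound a x (y ∷ xs) {v} (x~y ∷ walk) eq x<k (there w∈)  k≤w with foldStep-~ a x~y
  ... | inj₁ φx≡φy rewrite φx≡φy = s≤s (walk-bound a y xs walk eq)
  ... | inj₂ (_ , inj₂ (k≤x , _)) = contradiction x<k (≤⇒≯ k≤x)
  ... | inj₂ (_ , inj₁ (_ , y<k)) = s≤s (≤-trans
    (∣-∣-triangle (φ a x) (φ a y) (φ a v))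
    (≤-trans (+-monoˡ-≤ ∣ φ a y - φ a v ∣ (∣φ-φ∣≤1 a x~y))
      (crossing-walk-bound a y xs walk eq y<k w∈ k≤w)))

  crossing-path-bound : ∀ a {u v w xs} → IsPath u v xs →
                        offset a u < k → w List.∈ xs → k ≤ offset a w →
                        suc ∣ φ a u - φ a v ∣ < length xs
  crossing-path-bound a {xs = x ∷ xs} (refl , last≡v , walk , _) u<k w∈ k≤w =
    s≤s (crossing-walk-bound a x xs walk last≡v u<k w∈ k≤w)

  -- Antipodal pairs span the cycle.

  antipode : Fin n → Fin n
  antipode v = v ⊞ k

  antipode-involutive : ∀ v → antipode (antipode v) ≡ v
  antipode-involutive v = trans (⊞-assoc v k k) (⊞-n v)

  antipode-≢ : ∀ v → antipode v ≢ v
  antipode-≢ v eq = <⇒≢ 0<k (⊞-injective v 0<n k<n (trans (⊞-0 v) (sym eq)))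

  offset-self : (a : Fin n) → offset a a ≡ 0
  offset-self a = trans (cong (offset a) (sym (⊞-0 a))) (offset-⊞ a 0<n)

  arc-on-shortest-path : ∀ v {i} → i ≤ k → OnShortestPath v (antipode v) (v ⊞ i)
  arc-on-shortest-path v {i} i≤k =
    arc , (subst (λ u → IsPath u (antipode v) arc) (⊞-0 v) isPath , shortest) ,
    ∈-applyUpTo⁺ (v ⊞_) (s≤s i≤k)
    where
    arc : List (Fin n)
    arc = applyUpTo (v ⊞_) (suc k)

    isPath : IsPath (v ⊞ 0) (v ⊞ k) arc
    isPath = applyUpTo-isPath G (v ⊞_) k (λ {i} _ → inj₁ (⊞-⋯ v i)) λ i<j j≤k eq →
      <⇒≢ i<j (⊞-injective v (<-trans i<j (≤-<-trans j≤k k<n)) (≤-<-trans j≤k k<n) eq)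

    -- The fold sends offset `k` to `k - 1`, so the Lipschitz bound alone gives `k - 1` edges;
    -- crossing into the other half supplies the missing one.
    φ-distance : suc ∣ φ v v - φ v (antipode v) ∣ ≡ k
    φ-distance = begin
      suc ∣ φ v v - φ v (antipode v) ∣
        ≡⟨ cong₂ (λ c d → suc ∣ fold k c - fold k d ∣) (offset-self v) (offset-⊞ v k<n) ⟩
      suc (fold k k)                    ≡⟨ cong suc (fold-high ≤-refl) ⟩
      suc (k + k ∸ suc k)               ≡⟨ +-∸-assoc 1 k<n ⟨
      k + k ∸ k                         ≡⟨ m+n∸n≡m k k ⟩
      k                                 ∎
      where open ≡-Reasoning

    shortest : ∀ ys → IsPath v (antipode v) ys → length arc ≤ length ys
    shortest ys p@(_ , last≡ , _) = subst₂ _≤_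
      (trans (cong suc φ-distance) (sym (length-applyUpTo (v ⊞_) (suc k)))) refl
      (crossing-path-bound v p
        (subst (_< k) (sym (offset-self v)) 0<k)
        (last-∈ ys last≡)
        (≤-reflexive (sym (offset-⊞ v k<n))))

  antipodal-pair-spans : ∀ {S v} → v ∈ S → antipode v ∈ S → hull S ≡ ⊤
  antipodal-pair-spans {S} {v} v∈ v′∈ = ⊆-antisym ⊆⊤ λ {x} _ → ∈-hull⁺ (all-in x)
    where
    all-in : ∀ x K → Convex K → S ⊆ K → x ∈ K
    all-in x K convex S⊆K with offset v x ≤? k
    ... | yes ≤k = convex v (antipode v) x (S⊆K v∈) (S⊆K v′∈)
      (subst (OnShortestPath v (antipode v)) (⊞-offset v x) (arc-on-shortest-path v ≤k))
    -- A vertex more than `k` steps after `v` lies on the complementary arc, which runs from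
    -- `antipode v` on to `v`.
    ... | no ≰k = convex (antipode v) v x (S⊆K v′∈) (S⊆K v∈)
      (subst₂ (OnShortestPath (antipode v)) (antipode-involutive v)
        (trans (⊞-assoc v k (offset v x ∸ k))
          (trans (cong (v ⊞_) (m+[n∸m]≡n (<⇒≤ (≰⇒> ≰k)))) (⊞-offset v x)))
        (arc-on-shortest-path (antipode v)
          (m≤n+o⇒m∸n≤o (offset v x) k (<⇒≤ (offset<n v x)))))

  -- Half cycles are convex and proper.

  half : Fin n → Subset n
  half a = tabulate (does ∘ λ x → offset a x <? k)

  -- The competitor that defeats any path leaving the half: the direct arc, traversed forwards or
  -- backwards according to the order of the offsets.
  path-within-half : (a u v : Fin n) → offset a u < k → offset a v < k →
                     ∃ λ xs → IsPath u v xs × length xs ≡ suc ∣ offset a u - offset a v ∣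
  path-within-half a u v u<k v<k with ≤-total (offset a u) (offset a v)
  ... | inj₁ u≤v = applyUpTo p (suc m) ,
    subst₂ (λ u v → IsPath u v (applyUpTo p (suc m))) p0≡u pm≡v
      (applyUpTo-isPath G p m adj distinct) ,
    trans (length-applyUpTo p (suc m)) (cong suc (sym (m≤n⇒∣m-n∣≡n∸m u≤v)))
    where
    m : ℕ
    m = offset a v ∸ offset a u
    p : ℕ → Fin n
    p i = a ⊞ (offset a u + i)
    p0≡u : p 0 ≡ u
    p0≡u = trans (cong (a ⊞_) (+-identityʳ _)) (⊞-offset a u)
    pm≡v : p m ≡ v
    pm≡v = trans (cong (a ⊞_) (m+[n∸m]≡n u≤v)) (⊞-offset a v)
    adj : ∀ {i} → i < m → p i ~ p (suc i)
    adj {i} _ = inj₁ (subst (λ j → p i ⋯ (a ⊞ j)) (sym (+-suc (offset a u) i)) (⊞-⋯ a (offset a u + i)))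
    in-range : ∀ {j} → j ≤ m → offset a u + j < n
    in-range j≤m = ≤-<-trans
      (≤-trans (+-monoʳ-≤ (offset a u) j≤m) (≤-reflexive (m+[n∸m]≡n u≤v))) (offset<n a v)
    distinct : ∀ {i j} → i < j → j ≤ m → p i ≢ p j
    distinct {i} {j} i<j j≤m eq = <⇒≢ i<j (+-cancelˡ-≡ (offset a u) i j
      (⊞-injective a (in-range (≤-trans (<⇒≤ i<j) j≤m)) (in-range j≤m) eq))
  ... | inj₂ v≤u = applyUpTo p (suc m) ,
    subst₂ (λ u v → IsPath u v (applyUpTo p (suc m))) (⊞-offset a u) pm≡v
      (applyUpTo-isPath G p m adj distinct) ,
    trans (length-applyUpTo p (suc m)) (cong suc (sym (m≤n⇒∣n-m∣≡n∸m v≤u)))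
    where
    m : ℕ
    m = offset a u ∸ offset a v
    p : ℕ → Fin n
    -- The subtraction never truncates on the path, since `i` is at most `m`, hence at most
    -- `offset a u`.
    p i = a ⊞ (offset a u ∸ i)
    m≤u : m ≤ offset a u
    m≤u = m∸n≤m (offset a u) (offset a v)
    pm≡v : p m ≡ v
    pm≡v = trans (cong (a ⊞_) (m∸[m∸n]≡n v≤u)) (⊞-offset a v)
    adj : ∀ {i} → i < m → p i ~ p (suc i)
    adj {i} i<m = inj₂ (subst (λ j → p (suc i) ⋯ (a ⊞ j))
      (sym (+-∸-assoc 1 (≤-trans i<m m≤u))) (⊞-⋯ a (offset a u ∸ suc i)))
    in-range : ∀ j → offset a u ∸ j < n
    in-range j = ≤-<-trans (m∸n≤m (offset a u) j) (offset<n a u)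
    distinct : ∀ {i j} → i < j → j ≤ m → p i ≢ p j
    distinct {i} {j} i<j j≤m eq = <⇒≢ i<j
      (∸-cancelˡ-≡ (≤-trans (<⇒≤ i<j) (≤-trans j≤m m≤u)) (≤-trans j≤m m≤u)
        (⊞-injective a (in-range i) (in-range j) eq))

  -- On the half, `fold` is the identity, so a path that leaves it is strictly longer than the
  -- direct arc and cannot be shortest.
  half-convex : ∀ a → Convex (half a)
  half-convex a u v w u∈ v∈ (xs , (path , shortest) , w∈xs) with offset a w <? k
  ... | yes w<k = ∈-tabulate⁺ (λ x → offset a x <? k) w<k
  ... | no  w≮k
    with u<k ← ∈-tabulate⁻ (λ x → offset a x <? k) u∈
       | v<k ← ∈-tabulate⁻ (λ x → offset a x <? k) v∈
    with ys , path′ , length≡ ← path-within-half a u v u<k v<k =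
    contradiction (shortest ys path′) (<⇒≱ (subst (_< length xs)
      (trans (cong₂ (λ c d → suc ∣ c - d ∣) (fold-low u<k) (fold-low v<k)) (sym length≡))
      (crossing-path-bound a path u<k w∈xs (≮⇒≥ w≮k))))

  -- The vertex `antipode a` has offset exactly `k` and so lies just outside the half.
  subset-of-half-¬spans : ∀ a {S} → S ⊆ half a → hull S ≢ ⊤
  subset-of-half-¬spans a {S} S⊆ spans = <-irrefl (offset-⊞ a k<n)
    (∈-tabulate⁻ (λ x → offset a x <? k)
      (hull-least S (half a) (half-convex a) S⊆ (subst (antipode a ∈_) (sym spans) ∈⊤)))

  -- The forward steps from `x` to `y` and from `y` to `x` add up to `n` once the first number is
  -- positive.
  offset-flip : {x y : Fin n} → k < offset x y → offset y x < k
  offset-flip {x} {y} k<c = subst (_< k) (sym offset≡) n∸c<k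
    where
    c = offset x y
    n∸c<k : n ∸ c < k
    n∸c<k = subst (n ∸ c <_) (m+n∸n≡m k k) (∸-monoʳ-< k<c (<⇒≤ (offset<n x y)))
    offset≡ : offset y x ≡ n ∸ c
    offset≡ = begin
      offset y x                 ≡⟨ cong (offset y) (sym (⊞-n x)) ⟩
      offset y (x ⊞ n)           ≡⟨ cong (λ m → offset y (x ⊞ m)) (sym (m+[n∸m]≡n (<⇒≤ (offset<n x y)))) ⟩
      offset y (x ⊞ (c + (n ∸ c)))   ≡⟨ cong (offset y) (sym (⊞-assoc x c (n ∸ c))) ⟩
      offset y (x ⊞ c ⊞ (n ∸ c))     ≡⟨ cong (λ z → offset y (z ⊞ (n ∸ c))) (⊞-offset x y) ⟩
      offset y (y ⊞ (n ∸ c))         ≡⟨ offset-⊞ y (<-trans n∸c<k k<n) ⟩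
      n ∸ c                          ∎
      where open ≡-Reasoning

  -- Start the half at whichever vertex reaches the other in fewer than `k` forward steps; a tie
  -- would make them antipodal.
  half-containing : ∀ {x y} → y ≢ antipode x → ∃ λ a → x ∈ half a × y ∈ half a
  half-containing {x} {y} y≢x′ with <-cmp (offset x y) k
  ... | tri< c<k _ _ = x , self∈ x , ∈-tabulate⁺ (λ z → offset x z <? k) c<k
    where
    self∈ : ∀ x → x ∈ half x
    self∈ x = ∈-tabulate⁺ (λ z → offset x z <? k) (subst (_< k) (sym (offset-self x)) 0<k)
  ... | tri≈ _ c≡k _ = contradiction (trans (sym (⊞-offset x y)) (cong (x ⊞_) c≡k)) y≢x′
  ... | tri> _ _ k<c = y , ∈-tabulate⁺ (λ z → offset y z <? k) (offset-flip {x} {y} k<c) ,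
    ∈-tabulate⁺ (λ z → offset y z <? k) (subst (_< k) (sym (offset-self y)) 0<k)

  pair-¬spans : ∀ {S x y} → y ≢ antipode x → (∀ {z} → z ∈ S → z ≡ x ⊎ z ≡ y) → hull S ≢ ⊤
  pair-¬spans y≢x′ S⊆ =
    let a , x∈ , y∈ = half-containing y≢x′ in
    subset-of-half-¬spans a λ z∈ → [ (λ { refl → x∈ }) , (λ { refl → y∈ }) ]′ (S⊆ z∈)

  open Mirror antipode antipode-involutive

  nim≡0 : nim (TER G) ≡ 0
  nim≡0 = Strategy.nim≡0 G antipode-≢ antipodal-pair-spans pair-¬spans
    -- Neighbours lie in different antipodal pairs because 1 differs from `k`, which is at least 2.
    (mk v₀ (v₀ ⊞ 1) ∉⊥ ∉⊥
      (λ eq → 1+n≢0 (⊞-injective v₀ 1<n 0<n (trans eq (sym (⊞-0 v₀)))))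
      (λ eq → <⇒≢ 2≤k (⊞-injective v₀ 1<n k<n eq)))
    where
    1<n : 1 < n
    1<n = <-trans 2≤k k<n
    v₀ : Fin n
    v₀ = fromℕ< 0<n

proposition5p4 : (n : ℕ) (4≤n : 4 ≤ n) → 2 ∣ n → nim (TER (cycle n (≤-trans (n≤1+n 3) 4≤n))) ≡ 0
proposition5p4 n 4≤n (divides k n≡k*2) = even n 4≤n (trans n≡k*2 k*2≡k+k)
  where
  k*2≡k+k : k * 2 ≡ k + k
  k*2≡k+k = trans (*-comm k 2) (cong (k +_) (+-identityʳ k))
  -- Transporting along this equation keeps the type checker from comparing
  -- the two nim-values by unfolding the game.
  G≡cycle : ∀ k (4≤n : 4 ≤ k + k) → EvenCycle.G k 4≤n ≡ cycle (k + k) (≤-trans (n≤1+n 3) 4≤n)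
  G≡cycle k 4≤n = refl
  even : ∀ n (4≤n : 4 ≤ n) → n ≡ k + k → nim (TER (cycle n (≤-trans (n≤1+n 3) 4≤n))) ≡ 0
  even _ 4≤n refl = subst (λ G → nim (TER G) ≡ 0) (G≡cycle k 4≤n) (EvenCycle.nim≡0 k 4≤n)
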